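{- Let $n\ge 1$ be an integer and let $AQ_n$ be the $n$-dimensional augmented cube. Its distinguishing number is $$D(AQ_n)=\begin{cases}2 & \text{if } n=1,\\ 4 & \text{if } n=2,\\ 3 & \text{if } n=3,\\ 2 & \text{if } n\ge 4.\end{cases}$$
   Context: The augmented cube $AQ_n$ is a graph whose vertices are the binary strings $a_1\cdots a_n$ with $a_i\in\{0,1\}$, defined recursively. $AQ_1$ is the complete graph $K_2$ on the vertices $0$ and $1$. For $n>1$, take two copies $AQ_{n-1}^0$ and $AQ_{n-1}^1$ of $AQ_{n-1}$, with vertex sets $\{0a_2\cdots a_n : a_i\in\{0,1\}\}$ and $\{1b_2\cdots b_n : b_i\in\{0,1\}\}$ respectively (obtained by prefixing the vertex labels of $AQ_{n-1}$ with $0$, respectively $1$); $AQ_n$ consists of these two copies together with an edge between $0a_2\cdots a_n$ and $1b_2\cdots b_n$ whenever either (1) $a_i=b_i$ for each $2\le i\le n$, or (2) $a_i\neq b_i$ for each $2\le i\le n$. An $r$-coloring of a graph $G$ is any function $c\colon V(G)\to\{1,\dots,r\}$ (not required to be a proper coloring). An automorphism $\pi$ of $G$ preserves $c$ if $c(\pi v)=c(v)$ for every $v\in V(G)$. The coloring $c$ is distinguishing if no nontrivial automorphism of $G$ preserves it. The distinguishing number $D(G)$ is the smallest $r$ such that there exists a distinguishing $r$-coloring of $G$. -}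

module Defs where

open import Data.Bool.Base using (Bool)
open import Data.Fin.Base using (Fin)
open import Data.Nat.Base using (ℕ; zero; suc; _≤_; NonZero)
open import Data.Product.Base using (_×_; _,_; ∃-syntax)
open import Data.Sum.Base as Sum using (_⊎_; inj₁; inj₂)
open import Data.Vec.Base using (Vec; []; _∷_)
open import Data.Vec.Relation.Binary.Pointwise.Inductive as Pointwise using (Pointwise)
open import Function.Bundles using (_↔_; _⇔_; Inverse)
open import Relation.Binary.Core using (Rel)
open import Relation.Binary.Definitions using (Symmetric; Irreflexive)
open import Relation.Binary.PropositionalEquality
  using (_≡_; _≢_; refl; sym; ≢-sym)
open import Relation.Nullary.Negation using (¬_)
open import Level using (0ℓ)

record Graph : Set₁ where
  infix 4 _~_
  field
    Vertex   : Set
    _~_      : Rel Vertex 0ℓ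
    ~-sym    : Symmetric _~_
    ~-irrefl : Irreflexive _≡_ _~_

module _ (G : Graph) where
  open Graph G

  record Automorphism : Set where
    field
      bijection : Vertex ↔ Vertex

    open Inverse bijection public using (to; from)

    field
      adjacency : ∀ {u v} → u ~ v ⇔ to u ~ to v

  -- Colorings are arbitrary, not necessarily proper.
  Coloring : ℕ → Set
  Coloring r = Vertex → Fin r

module _ {G : Graph} where
  open Graph G
  open Automorphism

  Nontrivial : Automorphism G → Set
  Nontrivial π = ¬ (∀ v → to π v ≡ v)

  Preserves : ∀ {r} → Automorphism G → Coloring G r → Set
  Preserves π c = ∀ v → c (to π v) ≡ c v

  Distinguishing : ∀ {r} → Coloring G r → Set
  Distinguishing c = ¬ (∃[ π ] Nontrivial π × Preserves π c)

HasDistinguishingColoring : Graph → ℕ → Set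
HasDistinguishingColoring G r = ∃[ c ] Distinguishing {G} {r} c

-- The proposition D(G) = r.
IsDistinguishingNumber : Graph → ℕ → Set
IsDistinguishingNumber G r =
  HasDistinguishingColoring G r ×
  (∀ s → HasDistinguishingColoring G s → r ≤ s)

AQ-Adj : ∀ n .{{_ : NonZero n}} → Rel (Vec Bool n) 0ℓ
AQ-Adj (suc zero)    (a ∷ []) (b ∷ []) = a ≢ b
AQ-Adj (suc (suc n)) (a ∷ u)  (b ∷ v)  =
  (a ≡ b × AQ-Adj (suc n) u v) ⊎
  (a ≢ b × (Pointwise _≡_ u v ⊎ Pointwise _≢_ u v))

AQ-Adj-sym : ∀ n .{{_ : NonZero n}} → Symmetric (AQ-Adj n)
AQ-Adj-sym (suc zero)    {_ ∷ []} {_ ∷ []} a≢b = ≢-sym a≢b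
AQ-Adj-sym (suc (suc n)) {_ ∷ _}  {_ ∷ _}  (inj₁ (a≡b , u~v)) =
  inj₁ (sym a≡b , AQ-Adj-sym (suc n) u~v)
AQ-Adj-sym (suc (suc n)) {_ ∷ _}  {_ ∷ _}  (inj₂ (a≢b , p)) =
  inj₂ (≢-sym a≢b , Sum.map (Pointwise.sym sym) (Pointwise.sym ≢-sym) p)

AQ-Adj-irrefl : ∀ n .{{_ : NonZero n}} → Irreflexive _≡_ (AQ-Adj n)
AQ-Adj-irrefl (suc zero)    {_ ∷ []} refl a≢a              = a≢a refl
AQ-Adj-irrefl (suc (suc n)) {_ ∷ _}  refl (inj₁ (_ , u~u)) = AQ-Adj-irrefl (suc n) refl u~u
AQ-Adj-irrefl (suc (suc n)) {_ ∷ _}  refl (inj₂ (a≢a , _)) = a≢a refl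

AQ : ∀ n .{{_ : NonZero n}} → Graph
AQ n = record
  { Vertex   = Vec Bool n
  ; _~_      = AQ-Adj n
  ; ~-sym    = AQ-Adj-sym n
  ; ~-irrefl = AQ-Adj-irrefl n
  }

{-# OPTIONS --safe #-}
module Submission where

-- AQ_n is the Cayley graph of (ℤ/2)^n on the unit vectors and the vectors 0⋯01⋯1.
-- Edges of direction 0⋯01⋯1 with 2 ≤ k < n ones lie in four triangles, all other
-- edges in at most two; so automorphisms preserve the folded hypercube formed by the
-- latter edges. For n ≥ 4, v and v + a + b are the only common neighbours of v + a and
-- v + b in it, for distinct unit vectors a and b, so an automorphism that fixes 0 and
-- all unit vectors is trivial. The neighbours of 0 form a chain of triangles, along
-- which fixedness spreads from 0, 0⋯01 and 1⋯1. Finally these three vertices are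
-- fixed by every automorphism that preserves the set {0, 0⋯01, 0⋯011, 1⋯1}.

open import Defs
open import Data.Bool.Base using (Bool; true; false; _xor_; if_then_else_)
open import Data.Bool.Properties as Bool using (xor-assoc; xor-comm; xor-identityʳ; xor-same)
open import Data.Empty using (⊥)
open import Data.Fin.Base using (Fin; zero; suc; inject≤)
open import Data.Fin.Properties as Fin using (inject≤-injective; pigeonhole)
open import Data.Fin.Subset using (∣_∣)
open import Data.Fin.Subset.Properties using (∣⊤∣≡n; ∣⊥∣≡0)
open import Data.Nat.Base using (ℕ; zero; suc; _+_; _≤_; NonZero; _≥_; z≤n; s≤s)
import Data.Nat.Properties as ℕ
open import Data.Product.Base using (_×_; _,_; proj₁; proj₂; ∃₂; ∃-syntax)
open import Data.Sum.Base as Sum using (_⊎_; inj₁; inj₂; [_,_]′)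
open import Data.Unit.Base using (tt)
open import Data.Vec.Base using (Vec; []; _∷_; replicate; zipWith)
open import Data.Vec.Properties as Vec
  using (∷-injectiveʳ; zipWith-assoc; zipWith-comm; zipWith-identityˡ; zipWith-identityʳ)
open import Data.Vec.Relation.Binary.Pointwise.Inductive as Pointwise using (Pointwise; []; _∷_)
open import Function.Base using (_∘_)
open import Function.Bundles using (mk⇔; mk↔ₛ′; Equivalence; Inverse)
open import Relation.Binary.PropositionalEquality
  using (_≡_; _≢_; refl; sym; trans; cong; cong₂; subst; subst₂; ≢-sym; module ≡-Reasoning)
open import Relation.Nullary.Decidable as Dec
  using (Dec; yes; no; _×-dec_; _⊎-dec_; _→-dec_; ¬?; toWitness; does; dec-true)
open import Relation.Nullary.Negation using (¬_; contradiction)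

private
  variable
    k n : ℕ

-- The group (ℤ/2)^n

infixl 6 _⊕_
infix  4 _≟_

_⊕_ : Vec Bool n → Vec Bool n → Vec Bool n
_⊕_ = zipWith _xor_

_≟_ : (u v : Vec Bool n) → Dec (u ≡ v)
_≟_ = Vec.≡-dec Bool._≟_

zeros ones : Vec Bool n
zeros = replicate _ false
ones  = replicate _ true

⊕-assoc : (u v w : Vec Bool n) → u ⊕ v ⊕ w ≡ u ⊕ (v ⊕ w)
⊕-assoc = zipWith-assoc xor-assoc

⊕-comm : (u v : Vec Bool n) → u ⊕ v ≡ v ⊕ u
⊕-comm = zipWith-comm xor-comm

⊕-identityˡ : (u : Vec Bool n) → zeros ⊕ u ≡ u
⊕-identityˡ = zipWith-identityˡ λ _ → refl

⊕-identityʳ : (u : Vec Bool n) → u ⊕ zeros ≡ u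
⊕-identityʳ = zipWith-identityʳ xor-identityʳ

⊕-self : (u : Vec Bool n) → u ⊕ u ≡ zeros
⊕-self []      = refl
⊕-self (a ∷ u) = cong₂ _∷_ (xor-same a) (⊕-self u)

⊕-cancel : (u v : Vec Bool n) → u ⊕ (u ⊕ v) ≡ v
⊕-cancel u v = begin
  u ⊕ (u ⊕ v) ≡⟨ ⊕-assoc u u v ⟨
  u ⊕ u ⊕ v   ≡⟨ cong (_⊕ v) (⊕-self u) ⟩
  zeros ⊕ v   ≡⟨ ⊕-identityˡ v ⟩
  v           ∎
  where open ≡-Reasoning

⊕-injectiveʳ : (u : Vec Bool n) {v w : Vec Bool n} → u ⊕ v ≡ u ⊕ w → v ≡ w
⊕-injectiveʳ u {v} {w} eq = begin
  v           ≡⟨ ⊕-cancel u v ⟨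
  u ⊕ (u ⊕ v) ≡⟨ cong (u ⊕_) eq ⟩
  u ⊕ (u ⊕ w) ≡⟨ ⊕-cancel u w ⟩
  w           ∎
  where open ≡-Reasoning

⊕-move : {u v w : Vec Bool n} → u ⊕ v ≡ w → v ≡ u ⊕ w
⊕-move {u = u} {v} refl = sym (⊕-cancel u v)

⊕≡zeros⇒≡ : (u v : Vec Bool n) → u ⊕ v ≡ zeros → u ≡ v
⊕≡zeros⇒≡ u v eq = sym (trans (⊕-move eq) (⊕-identityʳ u))

⊕-swap : (u v w : Vec Bool n) → u ⊕ (v ⊕ w) ≡ v ⊕ (u ⊕ w)
⊕-swap u v w = begin
  u ⊕ (v ⊕ w) ≡⟨ ⊕-assoc u v w ⟨
  u ⊕ v ⊕ w   ≡⟨ cong (_⊕ w) (⊕-comm u v) ⟩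
  v ⊕ u ⊕ w   ≡⟨ ⊕-assoc v u w ⟩
  v ⊕ (u ⊕ w) ∎
  where open ≡-Reasoning

⊕-translate : (t u v : Vec Bool n) → (t ⊕ u) ⊕ (t ⊕ v) ≡ u ⊕ v
⊕-translate t u v = begin
  (t ⊕ u) ⊕ (t ⊕ v) ≡⟨ ⊕-swap (t ⊕ u) t v ⟩
  t ⊕ (t ⊕ u ⊕ v)   ≡⟨ cong (t ⊕_) (⊕-assoc t u v) ⟩
  t ⊕ (t ⊕ (u ⊕ v)) ≡⟨ ⊕-cancel t (u ⊕ v) ⟩
  u ⊕ v             ∎
  where open ≡-Reasoning

-- AQ_n as a Cayley graph

Const : Vec Bool n → Set
Const v = v ≡ zeros ⊎ v ≡ ones

-- The connection set of AQ_n: all entries after the first `true` agree, which leaves the unit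
-- vectors and the vectors 0⋯01⋯1.
Gen : Vec Bool n → Set
Gen []          = ⊥
Gen (true  ∷ v) = Const v
Gen (false ∷ v) = Gen v

Single : Vec Bool n → Set
Single []          = ⊥
Single (true  ∷ v) = v ≡ zeros
Single (false ∷ v) = Single v

-- The connection set of the folded hypercube.
Folded : Vec Bool n → Set
Folded v = Single v ⊎ v ≡ ones

Const-⊕ : {u v : Vec Bool n} → Const u → Const v → Const (u ⊕ v)
Const-⊕ {v = v} (inj₁ refl) p = subst Const (sym (⊕-identityˡ v)) p
Const-⊕ (inj₂ refl) (inj₁ refl) = inj₂ (⊕-identityʳ ones)
Const-⊕ (inj₂ refl) (inj₂ refl) = inj₁ (⊕-self ones)

-- Applied to a direction `false ∷ u`, this excludes common neighbours in the other copy of AQ_{n-1}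
-- as soon as `u` is not constant.
Const-⊕⁻ : (u : Vec Bool n) {v : Vec Bool n} → Const v → Const (u ⊕ v) → Const u
Const-⊕⁻ u {v} p q = subst Const eq (Const-⊕ p q)
  where
  eq : v ⊕ (u ⊕ v) ≡ u
  eq = trans (⊕-swap v u v) (trans (cong (u ⊕_) (⊕-self v)) (⊕-identityʳ u))

¬Gen-zeros : ∀ n → ¬ Gen (zeros {n})
¬Gen-zeros (suc n) = ¬Gen-zeros n

¬Gen-self : (u : Vec Bool n) → ¬ Gen (u ⊕ u)
¬Gen-self {n} u p = ¬Gen-zeros n (subst Gen (⊕-self u) p)

Single⇒Gen : (u : Vec Bool n) → Single u → Gen u
Single⇒Gen (true  ∷ u) p = inj₁ p
Single⇒Gen (false ∷ u) p = Single⇒Gen u p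

Gen-ones : ∀ n → Gen (ones {suc n})
Gen-ones n = inj₂ refl

Folded⇒Gen : (u : Vec Bool (suc n)) → Folded u → Gen u
Folded⇒Gen u (inj₁ p)    = Single⇒Gen u p
Folded⇒Gen u (inj₂ refl) = Gen-ones _

Gen? : (v : Vec Bool n) → Dec (Gen v)
Gen? []          = no λ ()
Gen? (true  ∷ v) = (v ≟ zeros) ⊎-dec (v ≟ ones)
Gen? (false ∷ v) = Gen? v

≢⇒ones : {u v : Vec Bool n} → Pointwise _≢_ u v → u ⊕ v ≡ ones
≢⇒ones [] = refl
≢⇒ones (_∷_ {x = true}  {y = true}  a≢b ps) = contradiction refl a≢b
≢⇒ones (_∷_ {x = true}  {y = false} a≢b ps) = cong (true ∷_) (≢⇒ones ps)
≢⇒ones (_∷_ {x = false} {y = true}  a≢b ps) = cong (true ∷_) (≢⇒ones ps)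
≢⇒ones (_∷_ {x = false} {y = false} a≢b ps) = contradiction refl a≢b

ones⇒≢ : (u v : Vec Bool n) → u ⊕ v ≡ ones → Pointwise _≢_ u v
ones⇒≢ []          []          eq = []
ones⇒≢ (true  ∷ u) (false ∷ v) eq = (λ ()) ∷ ones⇒≢ u v (∷-injectiveʳ eq)
ones⇒≢ (false ∷ u) (true  ∷ v) eq = (λ ()) ∷ ones⇒≢ u v (∷-injectiveʳ eq)

-- The two kinds of edges between the copies are those whose tails differ by 0⋯0 and by 1⋯1.
cross⇒Const : {u v : Vec Bool n} → Pointwise _≡_ u v ⊎ Pointwise _≢_ u v → Const (u ⊕ v)
cross⇒Const {v = v} (inj₁ p) with refl ← Pointwise.Pointwise-≡⇒≡ p = inj₁ (⊕-self v)
cross⇒Const         (inj₂ p) = inj₂ (≢⇒ones p)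

Const⇒cross : (u v : Vec Bool n) → Const (u ⊕ v) → Pointwise _≡_ u v ⊎ Pointwise _≢_ u v
Const⇒cross u v (inj₁ p) = inj₁ (Pointwise.≡⇒Pointwise-≡ (⊕≡zeros⇒≡ u v p))
Const⇒cross u v (inj₂ p) = inj₂ (ones⇒≢ u v p)

Adj⇒Gen : (u v : Vec Bool (suc n)) → AQ-Adj (suc n) u v → Gen (u ⊕ v)
Adj⇒Gen {zero}  (true  ∷ []) (true  ∷ []) a≢b = contradiction refl a≢b
Adj⇒Gen {zero}  (true  ∷ []) (false ∷ []) a≢b = inj₁ refl
Adj⇒Gen {zero}  (false ∷ []) (true  ∷ []) a≢b = inj₁ refl
Adj⇒Gen {zero}  (false ∷ []) (false ∷ []) a≢b = contradiction refl a≢b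
Adj⇒Gen {suc n} (true  ∷ u)  (true  ∷ v) (inj₁ (_ , p))   = Adj⇒Gen u v p
Adj⇒Gen {suc n} (true  ∷ u)  (true  ∷ v) (inj₂ (a≢b , _)) = contradiction refl a≢b
Adj⇒Gen {suc n} (true  ∷ u)  (false ∷ v) (inj₂ (_ , p))   = cross⇒Const p
Adj⇒Gen {suc n} (false ∷ u)  (true  ∷ v) (inj₂ (_ , p))   = cross⇒Const p
Adj⇒Gen {suc n} (false ∷ u)  (false ∷ v) (inj₁ (_ , p))   = Adj⇒Gen u v p
Adj⇒Gen {suc n} (false ∷ u)  (false ∷ v) (inj₂ (a≢b , _)) = contradiction refl a≢b

Gen⇒Adj : (u v : Vec Bool (suc n)) → Gen (u ⊕ v) → AQ-Adj (suc n) u v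
Gen⇒Adj {zero}  (true  ∷ []) (false ∷ []) p = λ ()
Gen⇒Adj {zero}  (false ∷ []) (true  ∷ []) p = λ ()
Gen⇒Adj {suc n} (true  ∷ u)  (true  ∷ v)  p = inj₁ (refl , Gen⇒Adj u v p)
Gen⇒Adj {suc n} (true  ∷ u)  (false ∷ v)  p = inj₂ ((λ ()) , Const⇒cross u v p)
Gen⇒Adj {suc n} (false ∷ u)  (true  ∷ v)  p = inj₂ ((λ ()) , Const⇒cross u v p)
Gen⇒Adj {suc n} (false ∷ u)  (false ∷ v)  p = inj₁ (refl , Gen⇒Adj u v p)

Adj? : (u v : Vec Bool (suc n)) → Dec (AQ-Adj (suc n) u v)
Adj? u v = Dec.map′ (Gen⇒Adj u v) (Adj⇒Gen u v) (Gen? (u ⊕ v))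

-- Common neighbours

-- h is a common neighbour of 0 and d in the Cayley graph.
Common : Vec Bool n → Vec Bool n → Set
Common d h = Gen h × Gen (d ⊕ h)

-- At least three triangles on an edge of direction `d`. Explicit witnesses replace a count and can
-- be pulled back along an automorphism.
record ThreeCommon (d : Vec Bool n) : Set where
  field
    h₁ h₂ h₃ : Vec Bool n
    h₁≢h₂    : h₁ ≢ h₂
    h₁≢h₃    : h₁ ≢ h₃
    h₂≢h₃    : h₂ ≢ h₃
    common₁  : Common d h₁
    common₂  : Common d h₂
    common₃  : Common d h₃

ThreeCommon-∷ : {d : Vec Bool n} → ThreeCommon d → ThreeCommon (false ∷ d)
ThreeCommon-∷ t = record
  { h₁      = false ∷ h₁
  ; h₂      = false ∷ h₂
  ; h₃      = false ∷ h₃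
  ; h₁≢h₂   = h₁≢h₂ ∘ ∷-injectiveʳ
  ; h₁≢h₃   = h₁≢h₃ ∘ ∷-injectiveʳ
  ; h₂≢h₃   = h₂≢h₃ ∘ ∷-injectiveʳ
  ; common₁ = common₁
  ; common₂ = common₂
  ; common₃ = common₃
  }
  where open ThreeCommon t

-- Leading zeros preserve triangles, so the only new case is a single zero in front of 1⋯1.
Gen⇒Folded⊎ThreeCommon : (d : Vec Bool n) → Gen d → Folded d ⊎ ThreeCommon d
Gen⇒Folded⊎ThreeCommon (true  ∷ d) (inj₁ p) = inj₁ (inj₁ p)
Gen⇒Folded⊎ThreeCommon (true  ∷ d) (inj₂ p) = inj₁ (inj₂ (cong (true ∷_) p))
Gen⇒Folded⊎ThreeCommon (false ∷ d) p with Gen⇒Folded⊎ThreeCommon d p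
... | inj₁ (inj₁ q) = inj₁ (inj₁ q)
... | inj₂ t        = inj₂ (ThreeCommon-∷ t)
Gen⇒Folded⊎ThreeCommon (false ∷ true ∷ [])        p | inj₁ (inj₂ refl) = inj₁ (inj₁ refl)
-- Two of the witnesses, 10⋯0 and 1⋯1, lie in the other copy and sum to `d`; the third comes from
-- 010⋯0 and 001⋯1 in the same copy.
Gen⇒Folded⊎ThreeCommon (false ∷ true ∷ true ∷ d) p | inj₁ (inj₂ refl) = inj₂ record
  { h₁      = true ∷ zeros
  ; h₂      = true ∷ ones
  ; h₃      = false ∷ true ∷ zeros
  ; h₁≢h₂   = λ ()
  ; h₁≢h₃   = λ ()
  ; h₂≢h₃   = λ ()
  ; common₁ = inj₁ refl , inj₂ (⊕-identityʳ ones)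
  ; common₂ = inj₂ refl , inj₁ (⊕-self ones)
  ; common₃ = inj₁ refl , inj₂ (⊕-identityʳ ones)
  }

-- Length at least 2 matters: in length 1 the unit vector is `ones`.
Single⇒¬Const : (d : Vec Bool (suc (suc n))) → Single d → ¬ Const d
Single⇒¬Const (true ∷ d) () (inj₂ refl)
Single⇒¬Const {n} .zeros p (inj₁ refl) = ¬Gen-zeros n (Single⇒Gen (zeros {n}) p)

-- For 10⋯0 the candidates are 1⋯1 and 01⋯1. A further leading zero adds no common neighbour,
-- because one in the other copy would force `d` to be constant.
Single⇒atMostTwo : (d : Vec Bool (suc (suc n))) → Single d →
  ∃₂ λ p q → ∀ h → Common d h → h ≡ p ⊎ h ≡ q
Single⇒atMostTwo {n} (true ∷ .zeros) refl = true ∷ ones , false ∷ ones , unique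
  where
  unique : ∀ h → Common (true ∷ zeros) h → h ≡ true ∷ ones ⊎ h ≡ false ∷ ones
  unique (true ∷ .zeros) (inj₁ refl , q) = contradiction q (¬Gen-self (zeros {suc n}))
  unique (true ∷ h)      (inj₂ p    , _) = inj₁ (cong (true ∷_) p)
  unique (false ∷ h)     (p , inj₁ q)
    with refl ← trans (sym (⊕-identityˡ h)) q = contradiction p (¬Gen-zeros n)
  unique (false ∷ h)     (_ , inj₂ q)    =
    inj₂ (cong (false ∷_) (trans (sym (⊕-identityˡ h)) q))
-- Here the tail of the direction is constant, and both common neighbours lie in the other copy.
Single⇒atMostTwo {zero} (false ∷ true ∷ []) refl = true ∷ true ∷ [] , true ∷ false ∷ [] , unique
  where
  unique : ∀ h → Common (false ∷ true ∷ []) h → h ≡ true ∷ true ∷ [] ⊎ h ≡ true ∷ false ∷ []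
  unique (true  ∷ true  ∷ []) _ = inj₁ refl
  unique (true  ∷ false ∷ []) _ = inj₂ refl
  unique (false ∷ true  ∷ []) (_ , ())
  unique (false ∷ false ∷ []) (() , _)
Single⇒atMostTwo {suc n} (false ∷ d) s with p , q , unique ← Single⇒atMostTwo d s =
  false ∷ p , false ∷ q , unique′
  where
  unique′ : ∀ h → Common (false ∷ d) h → h ≡ false ∷ p ⊎ h ≡ false ∷ q
  unique′ (true  ∷ h) (a , b) = contradiction (Const-⊕⁻ d a b) (Single⇒¬Const d s)
  unique′ (false ∷ h) c       = Sum.map (cong (false ∷_)) (cong (false ∷_)) (unique h c)

Folded⇒atMostTwo : (d : Vec Bool (suc (suc n))) → Folded d →
  ∃₂ λ p q → ∀ h → Common d h → h ≡ p ⊎ h ≡ q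
Folded⇒atMostTwo d (inj₁ s) = Single⇒atMostTwo d s
Folded⇒atMostTwo {n} _ (inj₂ refl) = true ∷ zeros , false ∷ ones , unique
  where
  unique : ∀ h → Common (true ∷ ones) h → h ≡ true ∷ zeros ⊎ h ≡ false ∷ ones
  unique (true  ∷ h)     (inj₁ p , _)    = inj₁ (cong (true ∷_) p)
  unique (true  ∷ .ones) (inj₂ refl , q) = contradiction q (¬Gen-self (ones {suc n}))
  unique (false ∷ h)     (_ , inj₁ q)    = inj₂ (cong (false ∷_) (sym (⊕≡zeros⇒≡ ones h q)))
  unique (false ∷ h)     (p , inj₂ q)
    with refl ← ⊕-injectiveʳ ones {h} {zeros} (trans q (sym (⊕-identityʳ ones))) =
    contradiction p (¬Gen-zeros n)

Folded⇒¬ThreeCommon : (d : Vec Bool (suc (suc n))) → Folded d → ¬ ThreeCommon d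
Folded⇒¬ThreeCommon d f t with p , q , unique ← Folded⇒atMostTwo d f =
  pick (unique h₁ common₁) (unique h₂ common₂) (unique h₃ common₃)
  where
  open ThreeCommon t
  pick : h₁ ≡ p ⊎ h₁ ≡ q → h₂ ≡ p ⊎ h₂ ≡ q → ¬ (h₃ ≡ p ⊎ h₃ ≡ q)
  pick (inj₁ a) (inj₁ b) _        = h₁≢h₂ (trans a (sym b))
  pick (inj₂ a) (inj₂ b) _        = h₁≢h₂ (trans a (sym b))
  pick (inj₁ a) (inj₂ b) (inj₁ c) = h₁≢h₃ (trans a (sym c))
  pick (inj₁ a) (inj₂ b) (inj₂ c) = h₂≢h₃ (trans b (sym c))
  pick (inj₂ a) (inj₁ b) (inj₁ c) = h₂≢h₃ (trans b (sym c))
  pick (inj₂ a) (inj₁ b) (inj₂ c) = h₁≢h₃ (trans a (sym c))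

-- Squares in the folded hypercube

∣⊕∣≤ : (u v : Vec Bool n) → ∣ u ⊕ v ∣ ≤ ∣ u ∣ + ∣ v ∣
∣⊕∣≤ []          []          = z≤n
∣⊕∣≤ (true  ∷ u) (true  ∷ v) = ℕ.m≤n⇒m≤1+n (ℕ.≤-trans (∣⊕∣≤ u v) (ℕ.+-monoʳ-≤ ∣ u ∣ (ℕ.n≤1+n ∣ v ∣)))
∣⊕∣≤ (true  ∷ u) (false ∷ v) = s≤s (∣⊕∣≤ u v)
∣⊕∣≤ (false ∷ u) (true  ∷ v) = subst (suc ∣ u ⊕ v ∣ ≤_) (sym (ℕ.+-suc ∣ u ∣ ∣ v ∣)) (s≤s (∣⊕∣≤ u v))
∣⊕∣≤ (false ∷ u) (false ∷ v) = ∣⊕∣≤ u v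

Single⇒∣∣≡1 : (u : Vec Bool n) → Single u → ∣ u ∣ ≡ 1
Single⇒∣∣≡1 {suc n} (true  ∷ .zeros) refl = cong suc (∣⊥∣≡0 n)
Single⇒∣∣≡1 (false ∷ u) s = Single⇒∣∣≡1 u s

-- Weight is subadditive, so the left side has at most three entries `true`. This is where the
-- square argument uses n ≥ 4.
threeSingles≢ones : (a b c : Vec Bool n) → 4 ≤ n →
  Single a → Single b → Single c → a ⊕ b ⊕ c ≢ ones
threeSingles≢ones {n} a b c 4≤n sa sb sc eq = contradiction (ℕ.≤-trans 4≤n n≤3) λ where
    (s≤s (s≤s (s≤s ())))
  where
  n≤3 : n ≤ 3
  n≤3 = begin
    n                     ≡⟨ ∣⊤∣≡n n ⟨
    ∣ ones {n} ∣          ≡⟨ cong ∣_∣ eq ⟨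
    ∣ a ⊕ b ⊕ c ∣         ≤⟨ ∣⊕∣≤ (a ⊕ b) c ⟩
    ∣ a ⊕ b ∣ + ∣ c ∣     ≤⟨ ℕ.+-monoˡ-≤ ∣ c ∣ (∣⊕∣≤ a b) ⟩
    ∣ a ∣ + ∣ b ∣ + ∣ c ∣ ≡⟨ cong₂ _+_ (cong₂ _+_ (Single⇒∣∣≡1 a sa) (Single⇒∣∣≡1 b sb)) (Single⇒∣∣≡1 c sc) ⟩
    3                     ∎
    where open ℕ.≤-Reasoning

-- The sum of two distinct unit vectors has exactly two entries `true`, and their positions
-- determine the summands up to order.
twoSingles-unique : (a b s t : Vec Bool n) → Single a → Single b → Single s → Single t →
  a ⊕ b ≡ s ⊕ t → a ≢ b → s ≡ a ⊎ s ≡ b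
twoSingles-unique (true  ∷ a) (true  ∷ b) _ _ refl refl _ _ _ a≢b = contradiction refl a≢b
twoSingles-unique (true  ∷ a) (false ∷ b) (true  ∷ s) _ refl _ refl _ _ _ = inj₁ refl
twoSingles-unique (true  ∷ a) (false ∷ b) (false ∷ s) (true ∷ t) refl _ _ refl eq _ =
  inj₂ (cong (false ∷_) (sym (begin
    b         ≡⟨ ⊕-identityˡ b ⟨
    zeros ⊕ b ≡⟨ ∷-injectiveʳ eq ⟩
    s ⊕ zeros ≡⟨ ⊕-identityʳ s ⟩
    s         ∎)))
  where open ≡-Reasoning
twoSingles-unique (false ∷ a) (true  ∷ b) (true  ∷ s) _ _ refl refl _ _ _ = inj₂ refl
twoSingles-unique (false ∷ a) (true  ∷ b) (false ∷ s) (true ∷ t) _ refl _ refl eq _ =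
  inj₁ (cong (false ∷_) (begin
    s         ≡⟨ ⊕-identityʳ s ⟨
    s ⊕ zeros ≡⟨ ∷-injectiveʳ eq ⟨
    a ⊕ zeros ≡⟨ ⊕-identityʳ a ⟩
    a         ∎))
  where open ≡-Reasoning
twoSingles-unique (false ∷ a) (false ∷ b) (true ∷ s) (true ∷ t) _ _ refl refl eq a≢b =
  contradiction (cong (false ∷_) (⊕≡zeros⇒≡ a b (trans (∷-injectiveʳ eq) (⊕-self zeros)))) a≢b
twoSingles-unique (false ∷ a) (false ∷ b) (false ∷ s) (false ∷ t) sa sb ss st eq a≢b =
  Sum.map (cong (false ∷_)) (cong (false ∷_))
    (twoSingles-unique a b s t sa sb ss st (∷-injectiveʳ eq) (a≢b ∘ cong (false ∷_)))

-- The differences `a ⊕ d` and `b ⊕ d` sum to `a ⊕ b`. If both are unit vectors, they are `a` and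
-- `b` in some order; if both are 1⋯1, then `a ≡ b`; if just one is 1⋯1, then 1⋯1 is a sum of three
-- unit vectors.
square-unique : 4 ≤ n → (a b d : Vec Bool n) → Single a → Single b → a ≢ b →
  Folded (a ⊕ d) → Folded (b ⊕ d) → d ≡ zeros ⊎ d ≡ a ⊕ b
square-unique 4≤n a b d sa sb a≢b (inj₁ p) (inj₁ q)
  with twoSingles-unique a b (a ⊕ d) (b ⊕ d) sa sb p q eq a≢b
  where
  eq : a ⊕ b ≡ (a ⊕ d) ⊕ (b ⊕ d)
  eq = sym (trans (cong₂ _⊕_ (⊕-comm a d) (⊕-comm b d)) (⊕-translate d a b))
... | inj₁ r = inj₁ (trans (⊕-move r) (⊕-self a))
... | inj₂ r = inj₂ (⊕-move r)
square-unique 4≤n a b d sa sb a≢b (inj₂ p) (inj₂ q) =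
  contradiction (⊕-injectiveʳ d (trans (⊕-comm d a) (trans p (trans (sym q) (⊕-comm b d))))) a≢b
square-unique 4≤n a b d sa sb a≢b (inj₁ p) (inj₂ q) =
  contradiction (trans eq q) (threeSingles≢ones b a (a ⊕ d) 4≤n sb sa p)
  where
  eq : b ⊕ a ⊕ (a ⊕ d) ≡ b ⊕ d
  eq = trans (⊕-assoc b a (a ⊕ d)) (cong (b ⊕_) (⊕-cancel a d))
square-unique 4≤n a b d sa sb a≢b (inj₂ p) (inj₁ q) =
  contradiction (trans eq p) (threeSingles≢ones a b (b ⊕ d) 4≤n sa sb q)
  where
  eq : a ⊕ b ⊕ (b ⊕ d) ≡ a ⊕ d
  eq = trans (⊕-assoc a b (b ⊕ d)) (cong (a ⊕_) (⊕-cancel b d))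

-- Automorphisms and the folded hypercube

module AutomorphismProperties {n} (π : Automorphism (AQ (suc (suc n)))) where
  open Automorphism π
  open Inverse bijection using (strictlyInverseˡ; strictlyInverseʳ)

  to-injective : ∀ {u v} → to u ≡ to v → u ≡ v
  to-injective {u} {v} eq =
    trans (sym (strictlyInverseʳ u)) (trans (cong from eq) (strictlyInverseʳ v))

  to-Gen : ∀ u v → Gen (u ⊕ v) → Gen (to u ⊕ to v)
  to-Gen u v p = Adj⇒Gen (to u) (to v) (Equivalence.to adjacency (Gen⇒Adj u v p))

  to-Gen⁻ : ∀ u v → Gen (to u ⊕ to v) → Gen (u ⊕ v)
  to-Gen⁻ u v p = Adj⇒Gen u v (Equivalence.from adjacency (Gen⇒Adj (to u) (to v) p))

  -- Triangles are pulled back by taking the preimage of the third vertex `to u ⊕ h` and then its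
  -- difference from `u`.
  to-ThreeCommon⁻ : ∀ u v → ThreeCommon (to u ⊕ to v) → ThreeCommon (u ⊕ v)
  to-ThreeCommon⁻ u v t = record
    { h₁      = pull h₁
    ; h₂      = pull h₂
    ; h₃      = pull h₃
    ; h₁≢h₂   = h₁≢h₂ ∘ pull-injective
    ; h₁≢h₃   = h₁≢h₃ ∘ pull-injective
    ; h₂≢h₃   = h₂≢h₃ ∘ pull-injective
    ; common₁ = pull-Common common₁
    ; common₂ = pull-Common common₂
    ; common₃ = pull-Common common₃
    }
    where
    open ThreeCommon t

    pre : Vec Bool (suc (suc n)) → Vec Bool (suc (suc n))
    pre h = from (to u ⊕ h)

    pull : Vec Bool (suc (suc n)) → Vec Bool (suc (suc n))
    pull h = u ⊕ pre h

    pull-injective : ∀ {g h} → pull g ≡ pull h → g ≡ h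
    pull-injective {g} {h} eq = ⊕-injectiveʳ (to u) (begin
      to u ⊕ g   ≡⟨ strictlyInverseˡ _ ⟨
      to (pre g) ≡⟨ cong to (⊕-injectiveʳ u eq) ⟩
      to (pre h) ≡⟨ strictlyInverseˡ _ ⟩
      to u ⊕ h   ∎)
      where open ≡-Reasoning

    pull-Common : ∀ {h} → Common (to u ⊕ to v) h → Common (u ⊕ v) (pull h)
    pull-Common {h} (p , q) =
      to-Gen⁻ u (pre h) (subst Gen (sym eq₁) p) ,
      subst Gen (sym (⊕-translate u v (pre h))) (to-Gen⁻ v (pre h) (subst Gen (sym eq₂) q))
      where
      eq₁ : to u ⊕ to (pre h) ≡ h
      eq₁ = trans (cong (to u ⊕_) (strictlyInverseˡ _)) (⊕-cancel (to u) h)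
      eq₂ : to v ⊕ to (pre h) ≡ to u ⊕ to v ⊕ h
      eq₂ = trans (cong (to v ⊕_) (strictlyInverseˡ _))
              (trans (⊕-swap (to v) (to u) h) (sym (⊕-assoc (to u) (to v) h)))

  -- Folded edges are exactly those lying in at most two triangles.
  to-Folded : ∀ u v → Folded (u ⊕ v) → Folded (to u ⊕ to v)
  to-Folded u v f with Gen⇒Folded⊎ThreeCommon (to u ⊕ to v) (to-Gen u v (Folded⇒Gen (u ⊕ v) f))
  ... | inj₁ f′ = f′
  ... | inj₂ t  = contradiction (to-ThreeCommon⁻ u v t) (Folded⇒¬ThreeCommon (u ⊕ v) f)

-- Every vector is reached from 0 by adding unit vectors: first those in the tail, then the one at
-- the head.
single-induction : (P : Vec Bool n → Set) → P zeros →
  (∀ v e → Single e → P v → P (v ⊕ e)) → ∀ v → P v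
single-induction P p step []          = p
single-induction P p step (a ∷ v) = prepend a
  where
  below : P (false ∷ v)
  below = single-induction (P ∘ (false ∷_)) p (λ v e → step (false ∷ v) (false ∷ e)) v

  prepend : ∀ a → P (a ∷ v)
  prepend false = below
  prepend true  = subst (P ∘ (true ∷_)) (⊕-identityʳ v) (step (false ∷ v) (true ∷ zeros) refl below)

module _ {n} (π : Automorphism (AQ (suc (suc n)))) (4≤n : 4 ≤ suc (suc n)) where
  open Automorphism π
  open AutomorphismProperties π

  private
    Fixed : Vec Bool (suc (suc n)) → Set
    Fixed v = to v ≡ v

  -- The induction carries along that all `v ⊕ e` are fixed. For `a ≢ b` the image of `v ⊕ a ⊕ b` is
  -- a folded neighbour of the fixed vertices `v ⊕ a` and `v ⊕ b`, hence equals `v` or `v ⊕ a ⊕ b`;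
  -- injectivity excludes `v`.
  fixesSingles⇒trivial : Fixed zeros → (∀ e → Single e → Fixed e) → ∀ v → Fixed v
  fixesSingles⇒trivial fix₀ fixSingle =
    proj₁ ∘ single-induction P (fix₀ , fix₀⊕) (λ v a sa (fv , fn) → fn a sa , step v a sa fv fn)
    where
    P : Vec Bool (suc (suc n)) → Set
    P v = Fixed v × ∀ e → Single e → Fixed (v ⊕ e)

    fix₀⊕ : ∀ e → Single e → Fixed (zeros ⊕ e)
    fix₀⊕ e s = subst Fixed (sym (⊕-identityˡ e)) (fixSingle e s)

    step : ∀ v a → Single a → Fixed v → (∀ e → Single e → Fixed (v ⊕ e)) →
      ∀ b → Single b → Fixed (v ⊕ a ⊕ b)
    step v a sa fv fn b sb with a ≟ b
    ... | yes refl = subst Fixed (sym vaa≡v) fv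
      where
      vaa≡v : v ⊕ a ⊕ a ≡ v
      vaa≡v = trans (⊕-assoc v a a) (trans (cong (v ⊕_) (⊕-self a)) (⊕-identityʳ v))
    ... | no a≢b = conclude (square-unique 4≤n a b d sa sb a≢b (folded a b sa sb refl)
                              (folded b a sb sa vba≡vab))
      where
      y = to (v ⊕ a ⊕ b)
      -- Translation by `v` moves the square to 0, where `square-unique` applies.
      d = v ⊕ y

      vba≡vab : v ⊕ b ⊕ a ≡ v ⊕ a ⊕ b
      vba≡vab = trans (⊕-assoc v b a) (trans (cong (v ⊕_) (⊕-comm b a)) (sym (⊕-assoc v a b)))

      folded : ∀ e e′ → Single e → Single e′ → v ⊕ e ⊕ e′ ≡ v ⊕ a ⊕ b → Folded (e ⊕ d)
      folded e e′ s s′ eq = subst Folded eq′ (to-Folded (v ⊕ e) (v ⊕ a ⊕ b) edge)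
        where
        edge : Folded ((v ⊕ e) ⊕ (v ⊕ a ⊕ b))
        edge = inj₁ (subst Single (sym (trans (cong (v ⊕ e ⊕_) (sym eq)) (⊕-cancel (v ⊕ e) e′))) s′)
        eq′ : to (v ⊕ e) ⊕ y ≡ e ⊕ d
        eq′ = trans (cong (_⊕ y) (trans (fn e s) (⊕-comm v e))) (⊕-assoc e v y)

      conclude : d ≡ zeros ⊎ d ≡ a ⊕ b → y ≡ v ⊕ a ⊕ b
      conclude (inj₁ p) = contradiction a≡b a≢b
        where
        v≡vab : v ≡ v ⊕ a ⊕ b
        v≡vab = to-injective (trans fv (⊕≡zeros⇒≡ v y p))
        a≡b : a ≡ b
        a≡b = ⊕≡zeros⇒≡ a b (⊕-injectiveʳ v
                (trans (sym (⊕-assoc v a b)) (trans (sym v≡vab) (sym (⊕-identityʳ v)))))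
      conclude (inj₂ p) = trans (⊕-move p) (sym (⊕-assoc v a b))

-- The chain of triangles in the neighbourhood of 0

-- With f k = 0⋯01⋯1 (k ones) and e k the unit vector in which f k and f (k + 1)
-- differ, Triangle k is inhabited by f k, e k, f (k + 1).
data Triangle : ∀ {n} → ℕ → (f e f′ : Vec Bool n) → Set where
  top  : Triangle {suc n} n (false ∷ ones) (true ∷ zeros) (true ∷ ones)
  skip : ∀ {f e f′ : Vec Bool n} → Triangle k f e f′ → Triangle k (false ∷ f) (false ∷ e) (false ∷ f′)

-- Two successive triangles of the chain, sharing `f₁`. Stored together, they can be compared by
-- recursion on the leading zeros.
data Consecutive : ∀ {n} → (f₀ e₀ f₁ e₁ f₂ : Vec Bool n) → Set where
  top  : Consecutive {suc (suc n)} (false ∷ false ∷ ones) (false ∷ true ∷ zeros)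
           (false ∷ true ∷ ones) (true ∷ zeros) (true ∷ ones)
  skip : ∀ {f₀ e₀ f₁ e₁ f₂ : Vec Bool n} → Consecutive f₀ e₀ f₁ e₁ f₂ →
           Consecutive (false ∷ f₀) (false ∷ e₀) (false ∷ f₁) (false ∷ e₁) (false ∷ f₂)

previous : ∀ {f₁ e₁ f₂ : Vec Bool n} → Triangle (suc k) f₁ e₁ f₂ →
  ∃₂ λ f₀ e₀ → Triangle k f₀ e₀ f₁ × Consecutive f₀ e₀ f₁ e₁ f₂
previous top      = _ , _ , skip top , top
previous (skip t) with _ , _ , t₀ , c ← previous t = _ , _ , skip t₀ , skip c

Single⇒Triangle : (e : Vec Bool n) → Single e → ∃[ k ] ∃₂ λ f f′ → Triangle k f e f′
Single⇒Triangle (true  ∷ .zeros) refl = _ , _ , _ , top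
Single⇒Triangle (false ∷ e) s with _ , _ , _ , t ← Single⇒Triangle e s = _ , _ , _ , skip t

Triangle⇒Single : ∀ {f e f′ : Vec Bool n} → Triangle k f e f′ → Single e
Triangle⇒Single top      = refl
Triangle⇒Single (skip t) = Triangle⇒Single t

Triangle⇒Gen : ∀ {f e f′ : Vec Bool n} → Triangle k f e f′ → Gen f′
Triangle⇒Gen top      = inj₂ refl
Triangle⇒Gen (skip t) = Triangle⇒Gen t

Triangle⇒⊕ : ∀ {f e f′ : Vec Bool n} → Triangle k f e f′ → f ⊕ e ≡ f′
Triangle⇒⊕ top      = cong (true ∷_) (⊕-identityʳ ones)
Triangle⇒⊕ (skip t) = cong (false ∷_) (Triangle⇒⊕ t)

unit₀ : ∀ n → Vec Bool (suc n)
unit₀ zero    = true ∷ []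
unit₀ (suc n) = false ∷ unit₀ n

-- The chain starts with a degenerate triangle, in which `e` and `f′` coincide.
Triangle₀ : ∀ {f e f′ : Vec Bool (suc n)} → Triangle 0 f e f′ →
  f ≡ zeros × e ≡ unit₀ n × f′ ≡ unit₀ n
Triangle₀ {zero}  top      = refl , refl , refl
Triangle₀ {zero}  (skip ())
Triangle₀ {suc n} (skip t) with refl , refl , refl ← Triangle₀ t = refl , refl , refl

Consecutive-¬Const : ∀ {f₀ e₀ f₁ e₁ f₂ : Vec Bool n} → Consecutive f₀ e₀ f₁ e₁ f₂ → ¬ Const f₁
Consecutive-¬Const top      (inj₁ ())
Consecutive-¬Const top      (inj₂ ())
Consecutive-¬Const (skip c) (inj₁ eq) = Consecutive-¬Const c (inj₁ (∷-injectiveʳ eq))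
Consecutive-¬Const (skip c) (inj₂ ())

Consecutive-¬Single : ∀ {f₀ e₀ f₁ e₁ f₂ : Vec Bool n} → Consecutive f₀ e₀ f₁ e₁ f₂ → ¬ Single f₂
Consecutive-¬Single top      ()
Consecutive-¬Single (skip c) = Consecutive-¬Single c

-- Once `f₀`, `e₀` and `f₁` are fixed, this leaves only `e₁` and `f₂` as images of `e₁`.
Consecutive-common : ∀ {f₀ e₀ f₁ e₁ f₂ : Vec Bool n} → Consecutive f₀ e₀ f₁ e₁ f₂ →
  ∀ g → Common f₁ g → g ≡ f₀ ⊎ g ≡ e₀ ⊎ g ≡ e₁ ⊎ g ≡ f₂
Consecutive-common top (true  ∷ g) (inj₁ p , _) = inj₂ (inj₂ (inj₁ (cong (true ∷_) p)))
Consecutive-common top (true  ∷ g) (inj₂ p , _) = inj₂ (inj₂ (inj₂ (cong (true ∷_) p)))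
Consecutive-common top (false ∷ true ∷ g) (inj₁ p , _) =
  inj₂ (inj₁ (cong (λ g → false ∷ true ∷ g) p))
Consecutive-common {suc (suc n)} top (false ∷ true ∷ .ones) (inj₂ refl , q) =
  contradiction q (¬Gen-self (ones {n}))
Consecutive-common top (false ∷ false ∷ g) (_ , inj₁ q) =
  inj₁ (cong (λ g → false ∷ false ∷ g) (sym (⊕≡zeros⇒≡ ones g q)))
Consecutive-common {suc (suc n)} top (false ∷ false ∷ g) (p , inj₂ q)
  with refl ← ⊕-injectiveʳ ones {g} {zeros} (trans q (sym (⊕-identityʳ ones))) =
  contradiction p (¬Gen-zeros n)
Consecutive-common {f₁ = _ ∷ f₁} (skip c) (true  ∷ g) (p , q) =
  contradiction (Const-⊕⁻ f₁ p q) (Consecutive-¬Const c)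
Consecutive-common (skip c) (false ∷ g) p =
  Sum.map (cong (false ∷_))
    (Sum.map (cong (false ∷_)) (Sum.map (cong (false ∷_)) (cong (false ∷_))))
    (Consecutive-common c g p)

-- The index `suc k` excludes the start of the chain: there `e` is 0⋯01, whose common neighbours
-- with 0 are 0⋯010 and 0⋯011.
Triangle-common : ∀ {f e f′ : Vec Bool (suc (suc n))} → Triangle (suc k) f e f′ →
  ∀ g → Common e g → g ≡ f ⊎ g ≡ f′
Triangle-common {n} top (true ∷ .zeros) (inj₁ refl , q) = contradiction q (¬Gen-self (zeros {suc n}))
Triangle-common top (true ∷ g) (inj₂ p , _) = inj₂ (cong (true ∷_) p)
Triangle-common {n} top (false ∷ g) (p , inj₁ q)
  with refl ← trans (sym (⊕-identityˡ g)) q = contradiction p (¬Gen-zeros n)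
Triangle-common top (false ∷ g) (_ , inj₂ q) = inj₁ (cong (false ∷_) (trans (sym (⊕-identityˡ g)) q))
Triangle-common {zero} (skip (skip ()))
Triangle-common {suc n} {e = _ ∷ e} (skip t) (true ∷ g) (p , q) =
  contradiction (Const-⊕⁻ e p q) (Single⇒¬Const e (Triangle⇒Single t))
Triangle-common {suc n} (skip t) (false ∷ g) p =
  Sum.map (cong (false ∷_)) (cong (false ∷_)) (Triangle-common t g p)

Consecutive-≢ : ∀ {f₀ e₀ f₁ e₁ f₂ : Vec Bool n} → Consecutive f₀ e₀ f₁ e₁ f₂ → e₁ ≢ f₀ × e₁ ≢ e₀
Consecutive-≢ top = (λ ()) , (λ ())
Consecutive-≢ (skip c) with p , q ← Consecutive-≢ c = p ∘ ∷-injectiveʳ , q ∘ ∷-injectiveʳ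

module _ {n} (π : Automorphism (AQ (suc (suc n)))) (4≤n : 4 ≤ suc (suc n)) where
  open Automorphism π
  open AutomorphismProperties π

  -- Along the chain, `f₁` is inherited from the previous triangle, `e₁` is recognised among the
  -- common neighbours of 0 and `f₁` by its folded edge to 0, and `f₂` is then the remaining common
  -- neighbour of 0 and `e₁`. Every unit vector occurs as some `e₁` or at the start.
  fixesAnchors⇒trivial : to zeros ≡ zeros → to (unit₀ (suc n)) ≡ unit₀ (suc n) → to ones ≡ ones →
    ∀ v → to v ≡ v
  fixesAnchors⇒trivial fix₀ fixUnit fixOnes = fixesSingles⇒trivial π 4≤n fix₀ fixSingle
    where
    to-Gen₀ : ∀ v → Gen v → Gen (to v)
    to-Gen₀ v p = subst Gen (trans (cong (_⊕ to v) fix₀) (⊕-identityˡ (to v)))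
      (to-Gen zeros v (subst Gen (sym (⊕-identityˡ v)) p))

    to-Folded₀ : ∀ v → Folded v → Folded (to v)
    to-Folded₀ v p = subst Folded (trans (cong (_⊕ to v) fix₀) (⊕-identityˡ (to v)))
      (to-Folded zeros v (subst Folded (sym (⊕-identityˡ v)) p))

    to-Common : ∀ {u v} → to u ≡ u → Common u v → Common u (to v)
    to-Common {u} {v} fu (p , q) = to-Gen₀ v p , subst (λ x → Gen (x ⊕ to v)) fu (to-Gen u v q)

    chain : ∀ k {f e f′} → Triangle k f e f′ → to f ≡ f × to e ≡ e × to f′ ≡ f′
    chain zero    t with refl , refl , refl ← Triangle₀ t = fix₀ , fixUnit , fixUnit
    chain (suc k) {f₁} {e₁} {f₂} t with f₀ , e₀ , t₀ , c ← previous t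
      with fix-f₀ , fix-e₀ , fix-f₁ ← chain k t₀ = fix-f₁ , fix-e₁ , fix-f₂
      where
      s : Single e₁
      s = Triangle⇒Single t

      locate-e₁ : to e₁ ≡ f₀ ⊎ to e₁ ≡ e₀ ⊎ to e₁ ≡ e₁ ⊎ to e₁ ≡ f₂ → to e₁ ≡ e₁
      locate-e₁ (inj₁ eq) =
        contradiction (to-injective (trans eq (sym fix-f₀))) (proj₁ (Consecutive-≢ c))
      locate-e₁ (inj₂ (inj₁ eq)) =
        contradiction (to-injective (trans eq (sym fix-e₀))) (proj₂ (Consecutive-≢ c))
      locate-e₁ (inj₂ (inj₂ (inj₁ eq))) = eq
      -- The edge from 0 to `e₁` is folded, so `f₂` would be a unit vector, which it is not, or 1⋯1.
      -- The latter is already fixed, so `e₁` would equal `f₂`.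
      locate-e₁ (inj₂ (inj₂ (inj₂ eq))) with subst Folded eq (to-Folded₀ e₁ (inj₁ s))
      ... | inj₁ single = contradiction single (Consecutive-¬Single c)
      ... | inj₂ f₂≡ones = contradiction (subst Single e₁≡f₂ s) (Consecutive-¬Single c)
        where
        e₁≡f₂ : e₁ ≡ f₂
        e₁≡f₂ = trans (to-injective (trans eq (trans f₂≡ones (sym fixOnes)))) (sym f₂≡ones)

      fix-e₁ : to e₁ ≡ e₁
      fix-e₁ = locate-e₁ (Consecutive-common c (to e₁) (to-Common fix-f₁
        (Single⇒Gen e₁ s , subst Gen (sym (Triangle⇒⊕ t)) (Triangle⇒Gen t))))

      e₁⊕f₂≡f₁ : e₁ ⊕ f₂ ≡ f₁
      e₁⊕f₂≡f₁ = sym (⊕-move (trans (⊕-comm e₁ f₁) (Triangle⇒⊕ t)))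

      locate-f₂ : to f₂ ≡ f₁ ⊎ to f₂ ≡ f₂ → to f₂ ≡ f₂
      locate-f₂ (inj₂ eq) = eq
      locate-f₂ (inj₁ eq) = contradiction
        (subst Gen (⊕-injectiveʳ f₁ f₁⊕e₁≡f₁⊕0) (Single⇒Gen e₁ s)) (¬Gen-zeros (suc (suc n)))
        where
        f₁⊕e₁≡f₁⊕0 : f₁ ⊕ e₁ ≡ f₁ ⊕ zeros
        f₁⊕e₁≡f₁⊕0 = trans (Triangle⇒⊕ t)
          (trans (to-injective (trans eq (sym fix-f₁))) (sym (⊕-identityʳ f₁)))

      fix-f₂ : to f₂ ≡ f₂
      fix-f₂ = locate-f₂ (Triangle-common t (to f₂) (to-Common fix-e₁
        (Triangle⇒Gen t , subst Gen (sym e₁⊕f₂≡f₁) (Triangle⇒Gen t₀))))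

    fixSingle : ∀ e → Single e → to e ≡ e
    fixSingle e s with k , _ , _ , t ← Single⇒Triangle e s = proj₁ (proj₂ (chain k t))

-- The vertices 0⋯01 and 0⋯011

pair₀ : ∀ n → Vec Bool (suc (suc n))
pair₀ zero    = true ∷ true ∷ []
pair₀ (suc n) = false ∷ pair₀ n

Single-unit₀ : ∀ n → Single (unit₀ n)
Single-unit₀ zero    = refl
Single-unit₀ (suc n) = Single-unit₀ n

unit₀-¬Const : ∀ n → ¬ Const (unit₀ (suc n))
unit₀-¬Const n = Single⇒¬Const (unit₀ (suc n)) (Single-unit₀ (suc n))

Gen-pair₀ : ∀ n → Gen (pair₀ n)
Gen-pair₀ zero    = inj₂ refl
Gen-pair₀ (suc n) = Gen-pair₀ n

¬Single-pair₀ : ∀ n → ¬ Single (pair₀ n)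
¬Single-pair₀ zero    ()
¬Single-pair₀ (suc n) = ¬Single-pair₀ n

pair₀-¬Const : ∀ n → ¬ Const (pair₀ (suc n))
pair₀-¬Const n (inj₁ eq) = ¬Gen-zeros (suc (suc n)) (subst Gen (∷-injectiveʳ eq) (Gen-pair₀ n))
pair₀-¬Const n (inj₂ ())

Gen-unit₀⊕pair₀ : ∀ n → Gen (unit₀ (suc n) ⊕ pair₀ n)
Gen-unit₀⊕pair₀ zero    = inj₁ refl
Gen-unit₀⊕pair₀ (suc n) = Gen-unit₀⊕pair₀ n

-- The distinguishing 2-coloring for n ≥ 4

-- In the graph induced on these four vertices, 0, unit₀ and pair₀ form a triangle
-- and 1⋯1 is a pendant vertex attached to 0; unit₀ and pair₀ are told apart by
-- whether their edge to 0 is folded.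
data Red {m} : Vec Bool (4 + m) → Set where
  zerosᵣ : Red zeros
  unitᵣ  : Red (unit₀ (3 + m))
  pairᵣ  : Red (pair₀ (2 + m))
  onesᵣ  : Red ones

Red? : ∀ {m} (v : Vec Bool (4 + m)) → Dec (Red v)
Red? {m} v = Dec.map′
  (λ { (inj₁ refl) → zerosᵣ ; (inj₂ (inj₁ refl)) → unitᵣ
     ; (inj₂ (inj₂ (inj₁ refl))) → pairᵣ ; (inj₂ (inj₂ (inj₂ refl))) → onesᵣ })
  (λ { zerosᵣ → inj₁ refl ; unitᵣ → inj₂ (inj₁ refl)
     ; pairᵣ → inj₂ (inj₂ (inj₁ refl)) ; onesᵣ → inj₂ (inj₂ (inj₂ refl)) })
  ((v ≟ zeros) ⊎-dec (v ≟ unit₀ (3 + m)) ⊎-dec (v ≟ pair₀ (2 + m)) ⊎-dec (v ≟ ones))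

indicator : {A : Set} → Dec A → Fin 2
indicator a? = if does a? then suc zero else zero

indicator-true : {A : Set} (a? : Dec A) → A → indicator a? ≡ suc zero
indicator-true a? a rewrite dec-true a? a = refl

indicator-true⁻ : {A : Set} (a? : Dec A) → indicator a? ≡ suc zero → A
indicator-true⁻ (yes a) _ = a
indicator-true⁻ (no _)  ()

red-coloring : ∀ {m} → Coloring (AQ (4 + m)) 2
red-coloring v = indicator (Red? v)

-- If `v` is 0⋯01 or 0⋯011, then `v ⊕ ones` begins with `true`, and adjacency would make the tail of
-- `v` constant. For 0⋯011 this is excluded because the tail has length at least 3.
ones-pendant : ∀ {m} {v : Vec Bool (4 + m)} → Red v → Gen (v ⊕ ones) → v ≡ zeros
ones-pendant zerosᵣ p = refl
ones-pendant {m} unitᵣ p =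
  contradiction (Const-⊕⁻ (unit₀ (2 + m)) (inj₂ refl) p) (unit₀-¬Const (1 + m))
ones-pendant {m} pairᵣ p =
  contradiction (Const-⊕⁻ (pair₀ (1 + m)) (inj₂ refl) p) (pair₀-¬Const m)
ones-pendant {m} onesᵣ p = contradiction p (¬Gen-self (ones {4 + m}))

red-coloring-distinguishing : ∀ {m} → Distinguishing {AQ (4 + m)} red-coloring
red-coloring-distinguishing {m} (π , nontrivial , preserves) =
  nontrivial (fixesAnchors⇒trivial π 4≤ fixZeros fixUnit fixOnes)
  where
  open Automorphism π
  open AutomorphismProperties π
  open Inverse bijection using (strictlyInverseˡ)

  4≤ : 4 ≤ 4 + m
  4≤ = s≤s (s≤s (s≤s (s≤s z≤n)))

  unit pair : Vec Bool (4 + m)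
  unit = unit₀ (3 + m)
  pair = pair₀ (2 + m)

  zeros≢unit : zeros ≢ unit
  zeros≢unit = unit₀-¬Const (2 + m) ∘ inj₁ ∘ sym

  zeros≢pair : zeros ≢ pair
  zeros≢pair = pair₀-¬Const (1 + m) ∘ inj₁ ∘ sym

  unit≢pair : unit ≢ pair
  unit≢pair eq = ¬Single-pair₀ (2 + m) (subst Single eq (Single-unit₀ (3 + m)))

  Gen-pair⊕unit : Gen (pair ⊕ unit)
  Gen-pair⊕unit = subst Gen (⊕-comm unit pair) (Gen-unit₀⊕pair₀ (2 + m))

  to-Red : ∀ {v} → Red v → Red (to v)
  to-Red {v} r = indicator-true⁻ (Red? _) (trans (preserves v) (indicator-true (Red? _) r))

  to-Red⁻ : ∀ {v} → Red (to v) → Red v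
  to-Red⁻ {v} r = indicator-true⁻ (Red? _) (trans (sym (preserves v)) (indicator-true (Red? _) r))

  to-ones-pendant : ∀ {v} → Red v → Gen (v ⊕ to ones) → v ≡ to zeros
  to-ones-pendant {v} r p = trans (sym (strictlyInverseˡ v)) (cong to (ones-pendant
    (to-Red⁻ (subst Red (sym (strictlyInverseˡ v)) r))
    (to-Gen⁻ (from v) ones (subst (λ x → Gen (x ⊕ to ones)) (sym (strictlyInverseˡ v)) p))))

  -- The red neighbours of `to ones` all equal `to zeros`, whereas each of the three other red
  -- vertices has two distinct red neighbours in the triangle.
  locate-ones : ∀ {v} → v ≡ to ones → Red v → to ones ≡ ones
  locate-ones eq onesᵣ = sym eq
  locate-ones eq zerosᵣ = contradiction
    (trans (nbr unitᵣ (Single⇒Gen unit (Single-unit₀ (3 + m)))) (sym (nbr pairᵣ (Gen-pair₀ (2 + m)))))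
    unit≢pair
    where
    nbr : ∀ {v} → Red v → Gen v → v ≡ to zeros
    nbr {v} r p = to-ones-pendant r
      (subst (λ x → Gen (v ⊕ x)) eq (subst Gen (sym (⊕-identityʳ v)) p))
  locate-ones eq unitᵣ = contradiction
    (trans (nbr zerosᵣ (subst Gen (sym (⊕-identityˡ unit)) (Single⇒Gen unit (Single-unit₀ (3 + m)))))
      (sym (nbr pairᵣ Gen-pair⊕unit)))
    zeros≢pair
    where
    nbr : ∀ {v} → Red v → Gen (v ⊕ unit) → v ≡ to zeros
    nbr {v} r p = to-ones-pendant r (subst (λ x → Gen (v ⊕ x)) eq p)
  locate-ones eq pairᵣ = contradiction
    (trans (nbr zerosᵣ (subst Gen (sym (⊕-identityˡ pair)) (Gen-pair₀ (2 + m))))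
      (sym (nbr unitᵣ (Gen-unit₀⊕pair₀ (2 + m)))))
    zeros≢unit
    where
    nbr : ∀ {v} → Red v → Gen (v ⊕ pair) → v ≡ to zeros
    nbr {v} r p = to-ones-pendant r (subst (λ x → Gen (v ⊕ x)) eq p)

  fixOnes : to ones ≡ ones
  fixOnes = locate-ones refl (to-Red onesᵣ)

  fixZeros : to zeros ≡ zeros
  fixZeros = sym (to-ones-pendant zerosᵣ (subst (λ x → Gen (zeros ⊕ x)) (sym fixOnes)
    (inj₂ (⊕-identityˡ ones))))

  locate-unit : ∀ {v} → v ≡ to unit → Red v → to unit ≡ unit
  locate-unit eq unitᵣ  = sym eq
  locate-unit eq zerosᵣ = contradiction (to-injective (trans fixZeros eq)) zeros≢unit
  locate-unit eq onesᵣ  =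
    contradiction (inj₂ (sym (to-injective (trans fixOnes eq)))) (unit₀-¬Const (2 + m))
  locate-unit eq pairᵣ  = contradiction
    (subst Folded (trans (cong₂ _⊕_ fixZeros (sym eq)) (⊕-identityˡ pair)) (to-Folded zeros unit
      (inj₁ (subst Single (sym (⊕-identityˡ unit)) (Single-unit₀ (3 + m))))))
    [ ¬Single-pair₀ (2 + m) , (λ ()) ]′

  fixUnit : to unit ≡ unit
  fixUnit = locate-unit refl (to-Red unitᵣ)

-- Symmetric colorings and the small cases

module _ (G : Graph) where
  open Graph G

  HasDistinguishingColoring-mono : ∀ {r s} → r ≤ s →
    HasDistinguishingColoring G r → HasDistinguishingColoring G s
  HasDistinguishingColoring-mono r≤s (c , distinguishing) =
    (λ v → inject≤ (c v) r≤s) ,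
    λ (π , nontrivial , preserves) →
      distinguishing (π , nontrivial , λ v → inject≤-injective r≤s r≤s _ _ (preserves v))

  -- Distinguishing colorings persist when colors are added, so refuting `r` colors refutes every
  -- smaller number too.
  ¬HasDistinguishingColoring⇒< : ∀ {r} → ¬ HasDistinguishingColoring G r →
    ∀ s → HasDistinguishingColoring G s → suc r ≤ s
  ¬HasDistinguishingColoring⇒< ¬h s h =
    ℕ.≰⇒> λ s≤r → ¬h (HasDistinguishingColoring-mono s≤r h)

  injective⇒Distinguishing : ∀ {r} (c : Coloring G r) → (∀ u v → c u ≡ c v → u ≡ v) →
    Distinguishing {G} c
  injective⇒Distinguishing c injective (π , nontrivial , preserves) =
    nontrivial λ v → injective _ _ (preserves v)

  -- An involution is its own inverse, so preserving adjacency in one direction already makes it an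
  -- automorphism.
  InvolutiveSymmetry : (Vertex → Vertex) → Set
  InvolutiveSymmetry f = (∀ v → f (f v) ≡ v) × (∀ u v → u ~ v → f u ~ f v)

  symmetry⇒¬Distinguishing : ∀ {r} (c : Coloring G r) {f} → InvolutiveSymmetry f →
    ∃[ v ] f v ≢ v → (∀ v → c (f v) ≡ c v) → ¬ Distinguishing {G} c
  symmetry⇒¬Distinguishing c {f} (involutive , preserves-~) (v , fv≢v) preserves distinguishing =
    distinguishing (π , (λ trivial → fv≢v (trivial v)) , preserves)
    where
    π : Automorphism G
    π = record
      { bijection = mk↔ₛ′ f f involutive involutive
      ; adjacency = λ {u} {v} → mk⇔ (preserves-~ u v)
          λ p → subst₂ _~_ (involutive u) (involutive v) (preserves-~ (f u) (f v) p)
      }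

-- Translations leave differences unchanged; this one shows that one color never suffices.
complement-symmetry : ∀ n → InvolutiveSymmetry (AQ (suc n)) (ones ⊕_)
complement-symmetry n = ⊕-cancel ones , λ u v p →
  Gen⇒Adj (ones ⊕ u) (ones ⊕ v) (subst Gen (sym (⊕-translate ones u v)) (Adj⇒Gen u v p))

¬HasDistinguishingColoring-1 : ∀ n → ¬ HasDistinguishingColoring (AQ (suc n)) 1
¬HasDistinguishingColoring-1 n (c , distinguishing) =
  symmetry⇒¬Distinguishing (AQ (suc n)) c (complement-symmetry n) (zeros , λ ())
    (λ v → unique (c (ones ⊕ v)) (c v)) distinguishing
  where
  unique : (i j : Fin 1) → i ≡ j
  unique zero zero = refl

-- Exhaustive search, by which claims about the small cubes are settled by evaluation.
∀-Vec? : ∀ {n} {P : Vec Bool n → Set} → (∀ v → Dec (P v)) → Dec (∀ v → P v)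
∀-Vec? {zero}  P? = Dec.map′ (λ { p [] → p }) (λ p → p []) (P? [])
∀-Vec? {suc n} P? = Dec.map′
  (λ { (p , q) (true ∷ v) → p v ; (p , q) (false ∷ v) → q v })
  (λ p → (λ v → p (true ∷ v)) , (λ v → p (false ∷ v)))
  (∀-Vec? (λ v → P? (true ∷ v)) ×-dec ∀-Vec? (λ v → P? (false ∷ v)))

InvolutiveSymmetry? : (f : Vec Bool (suc n) → Vec Bool (suc n)) →
  Dec (InvolutiveSymmetry (AQ (suc n)) f)
InvolutiveSymmetry? f =
  ∀-Vec? (λ v → f (f v) ≟ v) ×-dec
  ∀-Vec? (λ u → ∀-Vec? λ v → Adj? u v →-dec Adj? (f u) (f v))

Injective? : ∀ {r} (c : Vec Bool n → Fin r) → Dec (∀ u v → c u ≡ c v → u ≡ v)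
Injective? c = ∀-Vec? λ u → ∀-Vec? λ v → (c u Fin.≟ c v) →-dec (u ≟ v)

swap : Vec Bool n → Vec Bool n → Vec Bool n → Vec Bool n
swap u v w = if does (w ≟ u) then v else if does (w ≟ v) then u else w

swap-preserves : ∀ {A : Set} (c : Vec Bool n → A) u v → c u ≡ c v → ∀ w → c (swap u v w) ≡ c w
swap-preserves c u v eq w with w ≟ u
... | yes refl = sym eq
... | no _ with w ≟ v
...   | yes refl = eq
...   | no _     = refl

swap-moves : ∀ (u v : Vec Bool n) → u ≢ v → swap u v u ≢ u
swap-moves u v u≢v eq rewrite dec-true (u ≟ u) refl = u≢v (sym eq)

D-AQ₁ : IsDistinguishingNumber (AQ 1) 2
D-AQ₁ = (c , injective⇒Distinguishing (AQ 1) c (toWitness {a? = Injective? c} tt)) ,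
  ¬HasDistinguishingColoring⇒< (AQ 1) (¬HasDistinguishingColoring-1 0)
  where
  c : Vec Bool 1 → Fin 2
  c (a ∷ []) = if a then suc zero else zero

-- AQ_2 is the complete graph on four vertices, so two vertices of equal color can be exchanged.
D-AQ₂ : IsDistinguishingNumber (AQ 2) 4
D-AQ₂ = (c , injective⇒Distinguishing (AQ 2) c (toWitness {a? = Injective? c} tt)) ,
  ¬HasDistinguishingColoring⇒< (AQ 2) ¬3
  where
  c : Vec Bool 2 → Fin 4
  c (false ∷ false ∷ []) = zero
  c (false ∷ true  ∷ []) = suc zero
  c (true  ∷ false ∷ []) = suc (suc zero)
  c (true  ∷ true  ∷ []) = suc (suc (suc zero))

  vertex : Fin 4 → Vec Bool 2
  vertex zero                   = false ∷ false ∷ []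
  vertex (suc zero)             = false ∷ true  ∷ []
  vertex (suc (suc zero))       = true  ∷ false ∷ []
  vertex (suc (suc (suc zero))) = true  ∷ true  ∷ []

  c-vertex : ∀ i → c (vertex i) ≡ i
  c-vertex = toWitness {a? = Fin.all? λ i → c (vertex i) Fin.≟ i} tt

  swap-symmetry : ∀ u v → InvolutiveSymmetry (AQ 2) (swap u v)
  swap-symmetry = toWitness {a? = ∀-Vec? λ u → ∀-Vec? λ v → InvolutiveSymmetry? (swap u v)} tt

  ¬3 : ¬ HasDistinguishingColoring (AQ 2) 3
  ¬3 (c′ , distinguishing)
    with i , j , i<j , eq ← pigeonhole ℕ.≤-refl (c′ ∘ vertex) =
    symmetry⇒¬Distinguishing (AQ 2) c′ (swap-symmetry u v) (u , swap-moves u v u≢v)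
      (swap-preserves c′ u v eq) distinguishing
    where
    u = vertex i
    v = vertex j
    u≢v : u ≢ v
    u≢v p = Fin.<⇒≢ i<j (trans (sym (c-vertex i)) (trans (cong c p) (c-vertex j)))

-- The complement of AQ_3 consists of the two 4-cycles 000, 101, 011, 110 and
-- 001, 100, 010, 111.
D-AQ₃ : IsDistinguishingNumber (AQ 3) 3
D-AQ₃ = (c , distinguishing) , ¬HasDistinguishingColoring⇒< (AQ 3) ¬2
  where
  pattern O = false
  pattern I = true

  -- Each 4-cycle uses all three colors, repeating one on two adjacent vertices. The repeated colors
  -- differ, so the cycles cannot be exchanged, and the distinct colors of the other two vertices
  -- exclude a reflection.
  c : Vec Bool 3 → Fin 3
  c (O ∷ O ∷ O ∷ []) = zero
  c (I ∷ O ∷ I ∷ []) = zero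
  c (O ∷ I ∷ I ∷ []) = suc zero
  c (I ∷ I ∷ O ∷ []) = suc (suc zero)
  c (O ∷ O ∷ I ∷ []) = suc zero
  c (I ∷ O ∷ O ∷ []) = suc zero
  c (O ∷ I ∷ O ∷ []) = suc (suc zero)
  c (I ∷ I ∷ I ∷ []) = zero

  -- A path with two edges in the complement graph, which has the same automorphisms.
  CoPath : (x y z : Vec Bool 3) → Set
  CoPath x y z = (¬ AQ-Adj 3 x y × ¬ AQ-Adj 3 y z) × x ≢ y × y ≢ z × x ≢ z

  CoPath? : ∀ x y z → Dec (CoPath x y z)
  CoPath? x y z =
    (¬? (Adj? x y) ×-dec ¬? (Adj? y z)) ×-dec ¬? (x ≟ y) ×-dec ¬? (y ≟ z) ×-dec ¬? (x ≟ z)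

  -- No other complement path has the same sequence of colors, so color-preserving automorphisms fix
  -- this one pointwise.
  Rigid : (x y z : Vec Bool 3) → Set
  Rigid x y z = CoPath x y z × ∀ x′ y′ z′ →
    c x′ ≡ c x → c y′ ≡ c y → c z′ ≡ c z → CoPath x′ y′ z′ → x′ ≡ x × y′ ≡ y × z′ ≡ z

  Rigid? : ∀ x y z → Dec (Rigid x y z)
  Rigid? x y z = CoPath? x y z ×-dec ∀-Vec? λ x′ → ∀-Vec? λ y′ → ∀-Vec? λ z′ →
    (c x′ Fin.≟ c x) →-dec (c y′ Fin.≟ c y) →-dec (c z′ Fin.≟ c z) →-dec CoPath? x′ y′ z′ →-dec
    ((x′ ≟ x) ×-dec (y′ ≟ y) ×-dec (z′ ≟ z))

  distinguishing : Distinguishing {AQ 3} c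
  distinguishing (π , nontrivial , preserves) = nontrivial λ where
      (O ∷ O ∷ O ∷ []) → proj₁ (proj₂ p₁)
      (I ∷ O ∷ I ∷ []) → proj₁ p₁
      (I ∷ I ∷ O ∷ []) → proj₂ (proj₂ p₁)
      (O ∷ I ∷ I ∷ []) → proj₁ (proj₂ p₂)
      (I ∷ O ∷ O ∷ []) → proj₁ (proj₂ p₃)
      (O ∷ O ∷ I ∷ []) → proj₁ p₃
      (O ∷ I ∷ O ∷ []) → proj₂ (proj₂ p₃)
      (I ∷ I ∷ I ∷ []) → proj₁ (proj₂ p₄)
    where
    open Automorphism π
    open AutomorphismProperties π

    fixes : ∀ {x y z} → Rigid x y z → to x ≡ x × to y ≡ y × to z ≡ z
    fixes (((x≁y , y≁z) , x≢y , y≢z , x≢z) , unique) =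
      unique _ _ _ (preserves _) (preserves _) (preserves _)
        ( (x≁y ∘ Equivalence.from adjacency , y≁z ∘ Equivalence.from adjacency)
        , x≢y ∘ to-injective , y≢z ∘ to-injective , x≢z ∘ to-injective )

    -- Each 4-cycle is covered by two paths that join the same pair of opposite vertices.
    p₁ = fixes (toWitness {a? = Rigid? (I ∷ O ∷ I ∷ []) (O ∷ O ∷ O ∷ []) (I ∷ I ∷ O ∷ [])} tt)
    p₂ = fixes (toWitness {a? = Rigid? (I ∷ O ∷ I ∷ []) (O ∷ I ∷ I ∷ []) (I ∷ I ∷ O ∷ [])} tt)
    p₃ = fixes (toWitness {a? = Rigid? (O ∷ O ∷ I ∷ []) (I ∷ O ∷ O ∷ []) (O ∷ I ∷ O ∷ [])} tt)
    p₄ = fixes (toWitness {a? = Rigid? (O ∷ O ∷ I ∷ []) (I ∷ I ∷ I ∷ []) (O ∷ I ∷ O ∷ [])} tt)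

  ≢∧≢⇒≡ : {i j k : Fin 2} → i ≢ k → j ≢ k → i ≡ j
  ≢∧≢⇒≡ {zero}     {zero}     _   _   = refl
  ≢∧≢⇒≡ {suc zero} {suc zero} _   _   = refl
  ≢∧≢⇒≡ {zero}     {suc zero} {zero}     i≢k _ = contradiction refl i≢k
  ≢∧≢⇒≡ {zero}     {suc zero} {suc zero} _ j≢k = contradiction refl j≢k
  ≢∧≢⇒≡ {suc zero} {zero}     {zero}     _ j≢k = contradiction refl j≢k
  ≢∧≢⇒≡ {suc zero} {zero}     {suc zero} i≢k _ = contradiction refl i≢k

  v₀ v₁ v₂ v₃ : Vec Bool 3
  v₀ = O ∷ O ∷ O ∷ []
  v₁ = I ∷ O ∷ I ∷ []
  v₂ = O ∷ I ∷ I ∷ []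
  v₃ = I ∷ I ∷ O ∷ []

  -- A 2-coloring of the 4-cycle v₀v₁v₂v₃ is invariant under exchanging two
  -- opposite vertices or under reflecting the cycle in a bisector of two edges.
  ¬2 : ¬ HasDistinguishingColoring (AQ 3) 2
  ¬2 (c′ , distinguishing) with c′ v₀ Fin.≟ c′ v₂ | c′ v₁ Fin.≟ c′ v₃ | c′ v₀ Fin.≟ c′ v₁
  ... | yes eq | _ | _ = symmetry⇒¬Distinguishing (AQ 3) c′
    (toWitness {a? = InvolutiveSymmetry? (swap v₀ v₂)} tt) (v₀ , λ ())
    (swap-preserves c′ v₀ v₂ eq) distinguishing
  ... | no _ | yes eq | _ = symmetry⇒¬Distinguishing (AQ 3) c′
    (toWitness {a? = InvolutiveSymmetry? (swap v₁ v₃)} tt) (v₁ , λ ())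
    (swap-preserves c′ v₁ v₃ eq) distinguishing
  ... | no c₀≢c₂ | no c₁≢c₃ | yes eq = symmetry⇒¬Distinguishing (AQ 3) c′
    (toWitness {a? = InvolutiveSymmetry? (swap v₀ v₁ ∘ swap v₂ v₃)} tt) (v₀ , λ ())
    (λ w → trans (swap-preserves c′ v₀ v₁ eq (swap v₂ v₃ w)) (swap-preserves c′ v₂ v₃ c₂≡c₃ w))
    distinguishing
    where
    c₂≡c₃ : c′ v₂ ≡ c′ v₃
    c₂≡c₃ = ≢∧≢⇒≡ (≢-sym c₀≢c₂) (λ p → c₁≢c₃ (sym (trans p eq)))
  ... | no c₀≢c₂ | no c₁≢c₃ | no c₀≢c₁ = symmetry⇒¬Distinguishing (AQ 3) c′
    (toWitness {a? = InvolutiveSymmetry? (swap v₀ v₃ ∘ swap v₁ v₂)} tt) (v₀ , λ ())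
    (λ w → trans (swap-preserves c′ v₀ v₃ c₀≡c₃ (swap v₁ v₂ w)) (swap-preserves c′ v₁ v₂ c₁≡c₂ w))
    distinguishing
    where
    c₀≡c₃ : c′ v₀ ≡ c′ v₃
    c₀≡c₃ = ≢∧≢⇒≡ c₀≢c₁ (≢-sym c₁≢c₃)
    c₁≡c₂ : c′ v₁ ≡ c′ v₂
    c₁≡c₂ = ≢∧≢⇒≡ (≢-sym c₀≢c₁) (≢-sym c₀≢c₂)

D-AQ≥4 : ∀ m → IsDistinguishingNumber (AQ (4 + m)) 2
D-AQ≥4 m = (red-coloring , red-coloring-distinguishing) ,
  ¬HasDistinguishingColoring⇒< (AQ (4 + m)) (¬HasDistinguishingColoring-1 (3 + m))

theorem3p3 : ∀ (n : ℕ) .{{_ : NonZero n}} →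
    (n ≡ 1 → IsDistinguishingNumber (AQ n) 2) ×
    (n ≡ 2 → IsDistinguishingNumber (AQ n) 4) ×
    (n ≡ 3 → IsDistinguishingNumber (AQ n) 3) ×
    (n ≥ 4 → IsDistinguishingNumber (AQ n) 2)
theorem3p3 n = (λ { refl → D-AQ₁ }) , (λ { refl → D-AQ₂ }) , (λ { refl → D-AQ₃ }) ,
  λ { (s≤s (s≤s (s≤s (s≤s {n = m} z≤n)))) → D-AQ≥4 m }
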